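{- Let $\boldsymbol{\mu}=(\mu_1,\ldots,\mu_n)$ be an $n$-tuple of umbral monomials with generating function $f(\boldsymbol{\mu},\boldsymbol{t})$, and let $\gamma$ be an umbra with generating function $f(\gamma,t)$. Then the auxiliary umbra $(\mu_1+\cdots+\mu_n)\boldsymbol{.}\beta\boldsymbol{.}\gamma$ has generating function $$f[(\mu_1+\cdots+\mu_n)\boldsymbol{.}\beta\boldsymbol{.}\gamma,\,t]=f[\boldsymbol{\mu},(f(\gamma,t)-1,\ldots,f(\gamma,t)-1)],$$ an identity of formal power series in the single variable $t$ (with $n$ equal arguments $f(\gamma,t)-1$ on the right).
   Context: $R$ is the real or complex field, $A$ is a set (the alphabet) whose elements are called umbrae, and $E:R[A]\to R$ is a linear functional (evaluation) with $E[1]=1$ and $E[\alpha^i\gamma^j\cdots]=E[\alpha^i]E[\gamma^j]\cdots$ for distinct umbrae and nonnegative integers $i,j,\dots$. The moments of $\gamma\in A$ are $g_k=E[\gamma^k]$, and its generating function is $f(\gamma,t)=1+\sum_{k\ge1}g_k t^k/k!$. An $n$-tuple $\boldsymbol{\mu}=(\mu_1,\dots,\mu_n)$ of umbral monomials (monomials in $R[A]$, supports not necessarily disjoint) has multivariate moments $E[\boldsymbol{\mu}^{\boldsymbol{i}}]$, $\boldsymbol{\mu}^{\boldsymbol{i}}=\mu_1^{i_1}\cdots\mu_n^{i_n}$, $\boldsymbol{i}\in\mathbb{N}_0^n$, and generating function $f(\boldsymbol{\mu},\boldsymbol{t})=1+\sum_{\boldsymbol{i}\neq\boldsymbol{0}}E[\boldsymbol{\mu}^{\boldsymbol{i}}]\,\boldsymbol{t}^{\boldsymbol{i}}/\boldsymbol{i}!$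 with $\boldsymbol{i}!=i_1!\cdots i_n!$, $\boldsymbol{t}=(t_1,\dots,t_n)$, $\boldsymbol{t}^{\boldsymbol{i}}=t_1^{i_1}\cdots t_n^{i_n}$. For formal power series $s_1,\dots,s_n$ without constant term, $f[\boldsymbol{\mu},(s_1,\dots,s_n)]$ denotes the substitution $t_j\mapsto s_j$ in $f(\boldsymbol{\mu},\boldsymbol{t})$. For an integer partition $\lambda=(1^{r_1},2^{r_2},\dots)\vdash i$ let $\nu_\lambda=r_1+r_2+\cdots$ be its length, $\mathfrak{m}(\lambda)!=r_1!r_2!\cdots$, $\lambda!=(1!)^{r_1}(2!)^{r_2}\cdots$. The auxiliary umbra $p\boldsymbol{.}\beta\boldsymbol{.}\gamma$ ($\beta$ denotes the Bell umbra), for an umbral polynomial $p\in R[A]$ (here $p=\mu_1+\cdots+\mu_n$), is defined by its moments $$E[(p\boldsymbol{.}\beta\boldsymbol{.}\gamma)^i]=\sum_{\lambda\vdash i}\frac{i!}{\mathfrak{m}(\lambda)!\,\lambda!}\,E[p^{\nu_\lambda}]\,g_1^{r_1}g_2^{r_2}\cdots,\qquad i\ge0,$$ and its generating function is $f[p\boldsymbol{.}\beta\boldsymbol{.}\gamma,t]=1+\sum_{i\ge1}E[(p\boldsymbol{.}\beta\boldsymbol{.}\gamma)^i]\,t^i/i!$. -}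

module Defs where

open import Level using (Level; _⊔_)
open import Algebra.Bundles using (CommutativeRing; Semiring; RawSemiring)
open import Algebra.Apartness.Bundles using (HeytingCommutativeRing; HeytingField)
import Algebra.Definitions.RawSemiring as RawSemiringDefs
open import Data.Bool.Base using (if_then_else_)
open import Data.Fin.Base using (toℕ)
open import Data.List.Base as List using (List; []; _∷_; upTo; filter; cartesianProductWith)
open import Data.List.Relation.Unary.Unique.Propositional using (Unique)
open import Data.Nat.Base as ℕ using (ℕ; zero; suc; NonZero; _!)
import Data.Nat.Properties as ℕₚ
open import Data.Product.Base as Product using (∃-syntax; _,_; proj₁)
open import Data.Vec.Base as Vec using (Vec; []; _∷_)
open import Data.Vec.Properties using (≡-dec)
open import Relation.Nullary.Decidable.Core using (does)

HeytingField-ring : ∀ {c ℓ₁ ℓ₂} → HeytingField c ℓ₁ ℓ₂ → CommutativeRing c ℓ₁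
HeytingField-ring R = HeytingCommutativeRing.commutativeRing (HeytingField.heytingCommutativeRing R)

HeytingField-rawSemiring : ∀ {c ℓ₁ ℓ₂} → HeytingField c ℓ₁ ℓ₂ → RawSemiring c ℓ₁
HeytingField-rawSemiring R = Semiring.rawSemiring (CommutativeRing.semiring (HeytingField-ring R))

-- R = ℝ or ℂ enters only as a field of characteristic zero.
CharacteristicZero : ∀ {c ℓ₁ ℓ₂} → HeytingField c ℓ₁ ℓ₂ → Set ℓ₂
CharacteristicZero R = ∀ k .{{_ : NonZero k}} → (k × 1#) # 0#
  where
  open HeytingField R
  open RawSemiringDefs (HeytingField-rawSemiring R) using (_×_)

------------------------------------------------------------------------
-- Multi-indices and partitions

product : ∀ {n} → Vec ℕ n → ℕ
product = Vec.foldr′ ℕ._*_ 1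

product≢0 : ∀ {n} (f : ℕ → ℕ) (f≢0 : ∀ k → NonZero (f k)) (i : Vec ℕ n) → NonZero (product (Vec.map f i))
product≢0 f f≢0 []      = _
product≢0 f f≢0 (k ∷ i) = ℕₚ.m*n≢0 (f k) _ {{f≢0 k}} {{product≢0 f f≢0 i}}

infix 9 _!ᵥ

_!ᵥ : ∀ {n} → Vec ℕ n → ℕ
i !ᵥ = product (Vec.map _! i)

_!ᵥ≢0 : ∀ {n} (i : Vec ℕ n) → NonZero (i !ᵥ)
i !ᵥ≢0 = product≢0 _! ℕₚ._!≢0 i

-- All vectors of length n with entries in {0,…,b}, each listed once.
box : ∀ n → ℕ → List (Vec ℕ n)
box zero    b = [] ∷ []
box (suc n) b = cartesianProductWith _∷_ (upTo (suc b)) (box n b)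

multiIndices≤ : ∀ n → ℕ → List (Vec ℕ n)
multiIndices≤ n k = filter (λ i → Vec.sum i ℕₚ.≤? k) (box n k)

-- A partition (1^r₁, 2^r₂, …) of i is given by its multiplicities
-- r₁,…,rᵢ, since no part exceeds i; no multiplicity exceeds i either.
partSizes : ∀ i → Vec ℕ i
partSizes i = Vec.tabulate (λ j → suc (toℕ j))

weight : ∀ {i} → Vec ℕ i → ℕ
weight {i} r = Vec.sum (Vec.zipWith ℕ._*_ (partSizes i) r)

partitions : ∀ i → List (Vec ℕ i)
partitions i = filter (λ r → weight r ℕₚ.≟ i) (box i i)

ν : ∀ {i} → Vec ℕ i → ℕ
ν = Vec.sum

𝔪! : ∀ {i} → Vec ℕ i → ℕ
𝔪! r = r !ᵥ

part! : ∀ {i} → Vec ℕ i → ℕ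
part! {i} r = product (Vec.zipWith (λ j rⱼ → (j !) ℕ.^ rⱼ) (partSizes i) r)

part!≢0 : ∀ {i} (r : Vec ℕ i) → NonZero (part! r)
part!≢0 {i} r = go (partSizes i) r
  where
  go : ∀ {n} (js rs : Vec ℕ n) → NonZero (product (Vec.zipWith (λ j rⱼ → (j !) ℕ.^ rⱼ) js rs))
  go []       []       = _
  go (j ∷ js) (r ∷ rs) = ℕₚ.m*n≢0 ((j !) ℕ.^ r) _ {{ℕₚ.m^n≢0 (j !) r {{ℕₚ._!≢0 j}}}} {{go js rs}}

------------------------------------------------------------------------

module Umbral {c ℓ₁ ℓ₂ a : Level} (R : HeytingField c ℓ₁ ℓ₂) (char0 : CharacteristicZero R) (A : Set a) where

  open HeytingField R using (Carrier; _≈_; _+_; _*_; -_; 0#; 1#; #⇒invertible; -‿inverseʳ)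

  open RawSemiringDefs (HeytingField-rawSemiring R) using (_×_; _^_)

  infixl 7 _/_

  -- #⇒invertible inverts k × 1# - 0#.
  _/_ : Carrier → (k : ℕ) .{{_ : NonZero k}} → Carrier
  x / k = x * proj₁ (#⇒invertible (char0 k))

  ∑ : ∀ {b} {B : Set b} → List B → (B → Carrier) → Carrier
  ∑ xs f = List.foldr _+_ 0# (List.map f xs)

  ----------------------------------------------------------------------
  -- R[A], presented as the free commutative R-algebra on A: polynomial
  -- expressions modulo the congruence generated by the laws of
  -- commutative rings and by con being a ring homomorphism.

  infixl 6 _⊕_
  infixl 7 _⊗_
  infix  4 _≋_

  data Poly : Set (c ⊔ a) where
    con     : Carrier → Poly
    var     : A → Poly
    _⊕_ _⊗_ : Poly → Poly → Poly
    ⊖_      : Poly → Poly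

  data _≋_ : Poly → Poly → Set (c ⊔ ℓ₁ ⊔ a) where
    ≋-refl   : ∀ {p} → p ≋ p
    ≋-sym    : ∀ {p q} → p ≋ q → q ≋ p
    ≋-trans  : ∀ {p q r} → p ≋ q → q ≋ r → p ≋ r
    ⊕-cong   : ∀ {p p′ q q′} → p ≋ p′ → q ≋ q′ → p ⊕ q ≋ p′ ⊕ q′
    ⊗-cong   : ∀ {p p′ q q′} → p ≋ p′ → q ≋ q′ → p ⊗ q ≋ p′ ⊗ q′
    ⊖-cong   : ∀ {p p′} → p ≋ p′ → ⊖ p ≋ ⊖ p′
    ⊕-assoc  : ∀ p q r → (p ⊕ q) ⊕ r ≋ p ⊕ (q ⊕ r)
    ⊕-comm   : ∀ p q → p ⊕ q ≋ q ⊕ p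
    ⊕-idˡ    : ∀ p → con 0# ⊕ p ≋ p
    ⊖-invˡ   : ∀ p → ⊖ p ⊕ p ≋ con 0#
    ⊗-assoc  : ∀ p q r → (p ⊗ q) ⊗ r ≋ p ⊗ (q ⊗ r)
    ⊗-comm   : ∀ p q → p ⊗ q ≋ q ⊗ p
    ⊗-idˡ    : ∀ p → con 1# ⊗ p ≋ p
    ⊗-distˡ  : ∀ p q r → p ⊗ (q ⊕ r) ≋ p ⊗ q ⊕ p ⊗ r
    con-cong : ∀ {x y} → x ≈ y → con x ≋ con y
    con-+    : ∀ x y → con (x + y) ≋ con x ⊕ con y
    con-*    : ∀ x y → con (x * y) ≋ con x ⊗ con y

  R[A] : CommutativeRing (c ⊔ a) (c ⊔ ℓ₁ ⊔ a)
  R[A] = record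
    { Carrier = Poly ; _≈_ = _≋_
    ; _+_ = _⊕_ ; _*_ = _⊗_ ; -_ = ⊖_ ; 0# = con 0# ; 1# = con 1#
    ; isCommutativeRing = record
      { isRing = record
        { +-isAbelianGroup = record
          { isGroup = record
            { isMonoid = record
              { isSemigroup = record
                { isMagma = record
                  { isEquivalence = record { refl = ≋-refl ; sym = ≋-sym ; trans = ≋-trans }
                  ; ∙-cong = ⊕-cong }
                ; assoc = ⊕-assoc }
              ; identity = ⊕-idˡ , λ p → ≋-trans (⊕-comm p _) (⊕-idˡ p) }
            ; inverse = ⊖-invˡ , λ p → ≋-trans (⊕-comm p _) (⊖-invˡ p)
            ; ⁻¹-cong = ⊖-cong }
          ; comm = ⊕-comm }
        ; *-cong = ⊗-cong
        ; *-assoc = ⊗-assoc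
        ; *-identity = ⊗-idˡ , λ p → ≋-trans (⊗-comm p _) (⊗-idˡ p)
        ; distrib = ⊗-distˡ , λ p q r → ≋-trans (⊗-comm (q ⊕ r) p)
                      (≋-trans (⊗-distˡ p q r) (⊕-cong (⊗-comm p q) (⊗-comm p r))) }
      ; *-comm = ⊗-comm } }

  open RawSemiringDefs (Semiring.rawSemiring (CommutativeRing.semiring R[A])) public
    using () renaming (_^_ to infixr 8 _^ᴾ_)

  -- A scalar coefficient is allowed.
  IsMonomial : Poly → Set (c ⊔ ℓ₁ ⊔ a)
  IsMonomial p = ∃[ x ] ∃[ αs ] p ≋ con x ⊗ List.foldr (λ α → var α ⊗_) (con 1#) αs

  infixr 8 _^ᵥ_

  _^ᵥ_ : ∀ {n} → Vec Poly n → Vec ℕ n → Poly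
  μ ^ᵥ i = Vec.foldr′ _⊗_ (con 1#) (Vec.zipWith _^ᴾ_ μ i)

  sumᴾ : ∀ {n} → Vec Poly n → Poly
  sumᴾ = Vec.foldr′ _⊕_ (con 0#)

  record Evaluation : Set (c ⊔ ℓ₁ ⊔ a) where
    field
      E          : Poly → Carrier
      E-cong     : ∀ {p q} → p ≋ q → E p ≈ E q
      E-additive : ∀ p q → E (p ⊕ q) ≈ E p + E q
      E-scalar   : ∀ x p → E (con x ⊗ p) ≈ x * E p
      E-unit     : E (con 1#) ≈ 1#
      E-factor   : (αis : List (A Product.× ℕ)) → Unique (List.map proj₁ αis) →
                   E (List.foldr (λ (α , i) → var α ^ᴾ i ⊗_) (con 1#) αis)
                     ≈ List.foldr (λ (α , i) → E (var α ^ᴾ i) *_) 1# αis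

  ----------------------------------------------------------------------
  -- Formal power series, as sequences of coefficients of tᵏ (resp. 𝒕ⁱ)

  Series : Set c
  Series = ℕ → Carrier

  MultiSeries : ℕ → Set c
  MultiSeries n = Vec ℕ n → Carrier

  infix 4 _≈ˢ_

  _≈ˢ_ : Series → Series → Set ℓ₁
  s ≈ˢ u = ∀ k → s k ≈ u k

  0ˢ 1ˢ : Series
  0ˢ k       = 0#
  1ˢ zero    = 1#
  1ˢ (suc k) = 0#

  infixl 6 _+ˢ_ _-ˢ_
  infixl 7 _*ˢ_

  _+ˢ_ _-ˢ_ _*ˢ_ : Series → Series → Series
  (s +ˢ u) k = s k + u k
  (s -ˢ u) k = s k + - u k
  (s *ˢ u) k = ∑ (upTo (suc k)) (λ j → s j * u (k ℕ.∸ j))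

  Series-rawSemiring : RawSemiring c ℓ₁
  Series-rawSemiring = record { _≈_ = _≈ˢ_ ; _+_ = _+ˢ_ ; _*_ = _*ˢ_ ; 0# = 0ˢ ; 1# = 1ˢ }

  open RawSemiringDefs Series-rawSemiring using () renaming (_^_ to infixr 8 _^ˢ_)

  record Series₀ : Set (c ⊔ ℓ₁) where
    constructor _without-constant-by_
    field
      series     : Series
      constant≈0 : series 0 ≈ 0#

  open Series₀ public

  monomialˢ : ∀ {n} → Vec Series₀ n → Vec ℕ n → Series
  monomialˢ s i = Vec.foldr′ _*ˢ_ 1ˢ (Vec.zipWith (λ sⱼ iⱼ → series sⱼ ^ˢ iⱼ) s i)

  -- Substitution tⱼ ↦ sⱼ. As the sⱼ have no constant term, s₁^i₁⋯sₙ^iₙ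
  -- contributes nothing to the coefficient of tᵏ once i₁+⋯+iₙ > k, so
  -- the sum over all multi-indices is cut off at total degree k.
  _[_] : ∀ {n} → MultiSeries n → Vec Series₀ n → Series
  _[_] {n} F s k = ∑ (multiIndices≤ n k) (λ i → F i * monomialˢ s i k)

  -- 1 + Σ_{k≥1} m(k) tᵏ/k!
  gf : (ℕ → Carrier) → Series
  gf m zero      = 1#
  gf m k@(suc _) = (m k / k !) {{ℕₚ._!≢0 k}}

  gf-1 : (ℕ → Carrier) → Series₀
  gf-1 m = (gf m -ˢ 1ˢ) without-constant-by -‿inverseʳ 1#

  -- 1 + Σ_{i≠0} m(i) 𝒕ⁱ/i!
  gfᵥ : ∀ {n} → (Vec ℕ n → Carrier) → MultiSeries n
  gfᵥ {n} m i = if does (≡-dec ℕₚ._≟_ i (Vec.replicate n 0)) then 1# else (m i / i !ᵥ) {{i !ᵥ≢0}}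

  module Moments (ev : Evaluation) where

    open Evaluation ev

    moment : A → ℕ → Carrier
    moment γ k = E (var γ ^ᴾ k)

    momentᵥ : ∀ {n} → Vec Poly n → Vec ℕ n → Carrier
    momentᵥ μ i = E (μ ^ᵥ i)

    -- The auxiliary umbra p.β.γ, given by its sequence of moments.
    _·β·_ : Poly → A → ℕ → Carrier
    (p ·β· γ) i = ∑ (partitions i) λ r →
      (((i !) × 1#) / (𝔪! r ℕ.* part! r)) {{ℕₚ.m*n≢0 _ _ {{r !ᵥ≢0}} {{part!≢0 r}}}}
        * E (p ^ᴾ ν r)
        * Vec.foldr′ _*_ 1# (Vec.zipWith (λ j rⱼ → moment γ j ^ rⱼ) (partSizes i) r)

{-# OPTIONS --safe #-}
module Submission where

-- Both sides equal Σₘ E[pᵐ] sᵐ/m! with p = μ₁ + ⋯ + μₙ and s = f(γ,t) − 1.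
-- For this, let S(m, Φ) = m! Σ_{|i| = m} Φ(i)/i!.  Writing m + 1 as the sum of
-- the entries of i gives Euler's recursion S(0, Φ) = Φ(0) and
-- S(m + 1, Φ) = Σⱼ S(m, Φ(· + eⱼ)).  With Φ(i) = E[q 𝝁ⁱ] it yields
-- S(m, Φ) = E[q pᵐ], where q is arbitrary so that the induction can absorb μⱼ;
-- with Φ(r) = [Σ j rⱼ = k] Π sⱼ^rⱼ it is the recursion sᵐ⁺¹ = s sᵐ, so that
-- S(m, Φ) is the coefficient of tᵏ in sᵐ.  Sums over boxes are cut off at b,
-- which is harmless for m ≤ b.

open import Defs
open import Algebra.Apartness.Bundles using (HeytingField)
open import Algebra.Bundles using (CommutativeRing)
import Algebra.Definitions.RawSemiring as RawSemiringDefs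
import Algebra.Properties.CommutativeSemiring.Exp as Exp
import Algebra.Properties.Ring as RingProperties
import Algebra.Properties.Semiring.Mult as Mult
import Algebra.Solver.Ring.NaturalCoefficients.Default as Solver
open import Data.Bool.Base using (Bool; true; false)
open import Data.Fin.Base using (Fin; zero; suc; toℕ)
open import Data.List.Base as List using (List; []; _∷_; _++_; upTo; allFin; filter; cartesianProductWith)
import Data.List.Properties as Listₚ
open import Data.Nat.Base as ℕ using (ℕ; zero; suc; NonZero; _!; _≤_; _<_; z≤n; s≤s)
import Data.Nat.Properties as ℕₚ
open import Data.Product.Base using (proj₁; proj₂)
open import Data.Vec.Base as Vec using (Vec; []; _∷_; lookup; replicate)
import Data.Vec.Properties as Vecₚ
open import Data.Vec.Relation.Unary.All using (All)
open import Function.Base using (_∘_)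
open import Relation.Binary.PropositionalEquality as ≡ using (_≡_; _≢_)
open import Relation.Nullary.Decidable using (does; yes; no; dec-true; dec-false)
open import Relation.Unary using (Pred; Decidable)

-- Formally the common value is E[exp(p s)]. The right-hand side expands it as exp(μ₁ s) ⋯ exp(μₙ
-- s). The left-hand side expands each power of s = s₁ t + s₂ t² + ⋯, where the multiplicities of a
-- partition are the exponents of the monomials sⱼ tʲ. Both are instances of the multinomial
-- theorem, one in R[A] and one in power series, but each is needed only after a map to R: E in the
-- first case, extraction of a coefficient in the second. Neither map is multiplicative, so no
-- product formula holds for the values Φ(i) themselves. This is why S(m, Φ) takes an arbitrary
-- function Φ on multi-indices: the recursion only shifts the argument of Φ, and what a shift means
-- (a factor μⱼ under E, or a factor sⱼ tʲ) is settled afterwards by linearity in each case.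

infixl 8 _⁺_

-- This is i + eⱼ.
_⁺_ : ∀ {n} → Vec ℕ n → Fin n → Vec ℕ n
i ⁺ j = Vec.updateAt i j suc

sum-⁺ : ∀ {n} (i : Vec ℕ n) j → Vec.sum (i ⁺ j) ≡ suc (Vec.sum i)
sum-⁺ (a ∷ i) zero    = ≡.refl
sum-⁺ (a ∷ i) (suc j) = ≡.trans (≡.cong (a ℕ.+_) (sum-⁺ i j)) (ℕₚ.+-suc a _)

lookup≤sum : ∀ {n} (i : Vec ℕ n) j → lookup i j ≤ Vec.sum i
lookup≤sum (a ∷ i) zero    = ℕₚ.m≤m+n a _
lookup≤sum (a ∷ i) (suc j) = ℕₚ.≤-trans (lookup≤sum i j) (ℕₚ.m≤n+m _ a)

infix 8 _·_

-- `weight r` is this dot product of `partSizes` with r. The sizes are kept general for the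
-- inductions, since the tail of `partSizes` starts at 2 and is not again of that form.
_·_ : ∀ {n} → Vec ℕ n → Vec ℕ n → ℕ
v · r = Vec.sum (Vec.zipWith ℕ._*_ v r)

·-⁺ : ∀ {n} (v r : Vec ℕ n) j → v · (r ⁺ j) ≡ lookup v j ℕ.+ v · r
·-⁺ (d ∷ v) (a ∷ r) zero    =
  ≡.trans (≡.cong (ℕ._+ v · r) (ℕₚ.*-suc d a)) (ℕₚ.+-assoc d (d ℕ.* a) (v · r))
·-⁺ (d ∷ v) (a ∷ r) (suc j) = begin
  d ℕ.* a ℕ.+ v · (r ⁺ j)              ≡⟨ ≡.cong (d ℕ.* a ℕ.+_) (·-⁺ v r j) ⟩
  d ℕ.* a ℕ.+ (lookup v j ℕ.+ v · r)   ≡⟨ ℕₚ.+-assoc (d ℕ.* a) (lookup v j) (v · r) ⟨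
  d ℕ.* a ℕ.+ lookup v j ℕ.+ v · r     ≡⟨ ≡.cong (ℕ._+ v · r) (ℕₚ.+-comm (d ℕ.* a) (lookup v j)) ⟩
  lookup v j ℕ.+ d ℕ.* a ℕ.+ v · r     ≡⟨ ℕₚ.+-assoc (lookup v j) (d ℕ.* a) (v · r) ⟩
  lookup v j ℕ.+ (d ℕ.* a ℕ.+ v · r)   ∎
  where open ≡.≡-Reasoning

·-replicate-0 : ∀ {n} (v : Vec ℕ n) → v · replicate n 0 ≡ 0
·-replicate-0 []      = ≡.refl
·-replicate-0 (d ∷ v) = ≡.cong₂ ℕ._+_ (ℕₚ.*-zeroʳ d) (·-replicate-0 v)

sum≤· : ∀ {n} (v r : Vec ℕ n) → (∀ j → 1 ≤ lookup v j) → Vec.sum r ≤ v · r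
sum≤· []      []      1≤v = z≤n
sum≤· (d ∷ v) (a ∷ r) 1≤v =
  ℕₚ.+-mono-≤ (ℕₚ.m≤n*m a d {{ℕ.>-nonZero (1≤v zero)}}) (sum≤· v r (1≤v ∘ suc))

lookup-partSizes : ∀ {i} (j : Fin i) → lookup (partSizes i) j ≡ suc (toℕ j)
lookup-partSizes = Vecₚ.lookup∘tabulate (suc ∘ toℕ)

-- Every part has size at least 1. Hence the degrees m ≤ k exhaust the partitions of k.
sum≤weight : ∀ {i} (r : Vec ℕ i) → Vec.sum r ≤ weight r
sum≤weight r =
  sum≤· (partSizes _) r (λ j → ≡.subst (1 ≤_) (≡.sym (lookup-partSizes j)) (s≤s z≤n))

module UmbralProperties {c ℓ₁ ℓ₂ a} (R : HeytingField c ℓ₁ ℓ₂) (char0 : CharacteristicZero R) (A : Set a) where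

  open Umbral R char0 A
  open CommutativeRing (HeytingField-ring R)
    using ( Carrier; _≈_; _+_; _*_; -_; 0#; 1#; setoid; refl; sym; trans; reflexive
          ; +-cong; +-congˡ; +-congʳ; +-identityˡ; +-identityʳ; +-assoc; +-comm
          ; *-cong; *-congˡ; *-congʳ; *-identityˡ; *-identityʳ; *-assoc; *-comm
          ; zeroˡ; zeroʳ; distribˡ; distribʳ; ring; semiring; commutativeSemiring )
  open RawSemiringDefs (HeytingField-rawSemiring R) using (_×_; _^_)
  open RawSemiringDefs Series-rawSemiring using () renaming (_^_ to infixr 8 _^ˢ_)
  open Mult semiring using (×-homo-+; ×1-homo-*)
  open Exp commutativeSemiring using (^-distrib-*; ^-congˡ)
  open Solver commutativeSemiring using (solve; _:=_; _:*_; _:+_)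
  open import Relation.Binary.Reasoning.Setoid setoid

  -- Finite sums

  ∑-cong : ∀ {b} {B : Set b} (xs : List B) {f g : B → Carrier} →
           (∀ x → f x ≈ g x) → ∑ xs f ≈ ∑ xs g
  ∑-cong []       f≈g = refl
  ∑-cong (x ∷ xs) f≈g = +-cong (f≈g x) (∑-cong xs f≈g)

  ∑-zero : ∀ {b} {B : Set b} (xs : List B) {f : B → Carrier} →
           (∀ x → f x ≈ 0#) → ∑ xs f ≈ 0#
  ∑-zero []       f≈0 = refl
  ∑-zero (x ∷ xs) f≈0 = trans (+-cong (f≈0 x) (∑-zero xs f≈0)) (+-identityˡ 0#)

  ∑-distrib-+ : ∀ {b} {B : Set b} (xs : List B) (f g : B → Carrier) →
                ∑ xs (λ x → f x + g x) ≈ ∑ xs f + ∑ xs g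
  ∑-distrib-+ []       f g = sym (+-identityˡ 0#)
  ∑-distrib-+ (x ∷ xs) f g = trans (+-congˡ (∑-distrib-+ xs f g))
    (solve 4 (λ p q r s → (p :+ q) :+ (r :+ s) := (p :+ r) :+ (q :+ s)) refl _ _ _ _)

  *-distribˡ-∑ : ∀ {b} {B : Set b} (xs : List B) x (f : B → Carrier) →
                 x * ∑ xs f ≈ ∑ xs (λ y → x * f y)
  *-distribˡ-∑ []       x f = zeroʳ x
  *-distribˡ-∑ (y ∷ xs) x f = trans (distribˡ x _ _) (+-congˡ (*-distribˡ-∑ xs x f))

  *-distribʳ-∑ : ∀ {b} {B : Set b} (xs : List B) x (f : B → Carrier) →
                 ∑ xs f * x ≈ ∑ xs (λ y → f y * x)
  *-distribʳ-∑ []       x f = zeroˡ x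
  *-distribʳ-∑ (y ∷ xs) x f = trans (distribʳ x _ _) (+-congˡ (*-distribʳ-∑ xs x f))

  ∑-++ : ∀ {b} {B : Set b} (xs ys : List B) (f : B → Carrier) →
         ∑ (xs ++ ys) f ≈ ∑ xs f + ∑ ys f
  ∑-++ []       ys f = sym (+-identityˡ _)
  ∑-++ (x ∷ xs) ys f = trans (+-congˡ (∑-++ xs ys f)) (sym (+-assoc _ _ _))

  ∑-map : ∀ {b d} {B : Set b} {D : Set d} (g : B → D) (xs : List B) (f : D → Carrier) →
          ∑ (List.map g xs) f ≡ ∑ xs (f ∘ g)
  ∑-map g xs f = ≡.cong (List.foldr _+_ 0#) (≡.sym (Listₚ.map-∘ xs))

  ∑-comm : ∀ {b d} {B : Set b} {D : Set d} (xs : List B) (ys : List D) (f : B → D → Carrier) →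
           ∑ xs (λ x → ∑ ys (f x)) ≈ ∑ ys (λ y → ∑ xs (λ x → f x y))
  ∑-comm []       ys f = sym (∑-zero ys (λ _ → refl))
  ∑-comm (x ∷ xs) ys f =
    trans (+-congˡ (∑-comm xs ys f)) (sym (∑-distrib-+ ys (f x) _))

  ∑-cartesianProductWith :
    ∀ {b d e} {B : Set b} {D : Set d} {G : Set e} (g : B → D → G) xs ys (f : G → Carrier) →
    ∑ (cartesianProductWith g xs ys) f ≈ ∑ xs (λ x → ∑ ys (λ y → f (g x y)))
  ∑-cartesianProductWith g []       ys f = refl
  ∑-cartesianProductWith g (x ∷ xs) ys f = trans (∑-++ (List.map (g x) ys) _ f)
    (+-cong (reflexive (∑-map (g x) ys f)) (∑-cartesianProductWith g xs ys f))

  ∑-upTo-suc : ∀ n (f : ℕ → Carrier) → ∑ (upTo (suc n)) f ≡ f 0 + ∑ (upTo n) (f ∘ suc)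
  ∑-upTo-suc n f = ≡.cong (f 0 +_)
    (≡.trans (≡.cong (λ xs → ∑ xs f) (≡.sym (Listₚ.map-upTo suc n))) (∑-map suc (upTo n) f))

  ∑-upTo-last : ∀ n (f : ℕ → Carrier) → ∑ (upTo (suc n)) f ≈ ∑ (upTo n) f + f n
  ∑-upTo-last n f = begin
    ∑ (upTo (suc n)) f            ≡⟨ ≡.cong (λ xs → ∑ xs f) (Listₚ.upTo-∷ʳ n) ⟨
    ∑ (upTo n List.∷ʳ n) f        ≈⟨ ∑-++ (upTo n) (n ∷ []) f ⟩
    ∑ (upTo n) f + (f n + 0#)     ≈⟨ +-congˡ (+-identityʳ (f n)) ⟩
    ∑ (upTo n) f + f n            ∎

  ∑-upTo-cong : ∀ n {f g : ℕ → Carrier} → (∀ k → k < n → f k ≈ g k) →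
                ∑ (upTo n) f ≈ ∑ (upTo n) g
  ∑-upTo-cong zero    f≈g = refl
  ∑-upTo-cong (suc n) {f} {g} f≈g = begin
    ∑ (upTo (suc n)) f              ≡⟨ ∑-upTo-suc n f ⟩
    f 0 + ∑ (upTo n) (f ∘ suc)      ≈⟨ +-cong (f≈g 0 (s≤s z≤n)) (∑-upTo-cong n (λ k k<n → f≈g (suc k) (s≤s k<n))) ⟩
    g 0 + ∑ (upTo n) (g ∘ suc)      ≡⟨ ∑-upTo-suc n g ⟨
    ∑ (upTo (suc n)) g              ∎

  ∑-allFin-suc : ∀ n (f : Fin (suc n) → Carrier) →
                 ∑ (allFin (suc n)) f ≡ f zero + ∑ (allFin n) (f ∘ suc)
  ∑-allFin-suc n f = ≡.cong (f zero +_)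
    (≡.trans (≡.cong (λ xs → ∑ xs f) (≡.sym (Listₚ.map-tabulate (λ j → j) suc))) (∑-map suc (allFin n) f))

  ∑-box : ∀ n b (F : Vec ℕ (suc n) → Carrier) →
          ∑ (box (suc n) b) F ≈ ∑ (upTo (suc b)) (λ k → ∑ (box n b) (λ i → F (k ∷ i)))
  ∑-box n b F = ∑-cartesianProductWith _∷_ (upTo (suc b)) (box n b) F

  -- Indicators

  ⟦_⟧ : Bool → Carrier
  ⟦ true  ⟧ = 1#
  ⟦ false ⟧ = 0#

  ∑-filter : ∀ {b p} {B : Set b} {P : Pred B p} (P? : Decidable P) xs (f : B → Carrier) →
             ∑ (filter P? xs) f ≈ ∑ xs (λ x → ⟦ does (P? x) ⟧ * f x)
  ∑-filter P? []       f = refl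
  ∑-filter P? (x ∷ xs) f with does (P? x)
  ... | true  = +-cong (sym (*-identityˡ _)) (∑-filter P? xs f)
  ... | false = trans (∑-filter P? xs f) (sym (trans (+-congʳ (zeroˡ _)) (+-identityˡ _)))

  δ : ℕ → ℕ → Carrier
  δ m n = ⟦ does (m ℕₚ.≟ n) ⟧

  δ-≢ : ∀ {m n} → m ≢ n → δ m n ≈ 0#
  δ-≢ {m} {n} m≢n = reflexive (≡.cong ⟦_⟧ (dec-false (m ℕₚ.≟ n) m≢n))

  -- With m the degree of the summation index, this turns a factor that depends on the degree into a
  -- constant, which can then leave the sum.
  δ-subst : ∀ m n (f : ℕ → Carrier) → δ m n * f m ≈ δ m n * f n
  δ-subst m n f with m ℕₚ.≟ n
  ... | yes ≡.refl = refl
  ... | no  m≢n    = trans (*-congʳ (δ-≢ m≢n)) (trans (zeroˡ _) (sym (trans (*-congʳ (δ-≢ m≢n)) (zeroˡ _))))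

  ∑-δ : ∀ {m} k → m ≤ k → ∑ (upTo (suc k)) (δ m) ≈ 1#
  ∑-δ {zero}  k       _         = begin
    ∑ (upTo (suc k)) (δ 0)        ≡⟨ ∑-upTo-suc k (δ 0) ⟩
    1# + ∑ (upTo k) (λ _ → 0#)    ≈⟨ +-congˡ (∑-zero (upTo k) (λ _ → refl)) ⟩
    1# + 0#                       ≈⟨ +-identityʳ 1# ⟩
    1#                            ∎
  ∑-δ {suc m} (suc k) (s≤s m≤k) = begin
    ∑ (upTo (suc (suc k))) (δ (suc m))  ≡⟨ ∑-upTo-suc (suc k) (δ (suc m)) ⟩
    0# + ∑ (upTo (suc k)) (δ m)         ≈⟨ +-identityˡ _ ⟩
    ∑ (upTo (suc k)) (δ m)              ≈⟨ ∑-δ k m≤k ⟩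
    1#                                  ∎

  -- If |i| ≤ k, exactly one of the indicators for m = 0, ..., k equals 1; otherwise F i vanishes,
  -- and so does every term on the right.
  ∑-by-degree : ∀ {n} (is : List (Vec ℕ n)) k (F : Vec ℕ n → Carrier) →
                (∀ i → k < Vec.sum i → F i ≈ 0#) →
                ∑ is F ≈ ∑ (upTo (suc k)) (λ m → ∑ is (λ i → δ (Vec.sum i) m * F i))
  ∑-by-degree is k F F≈0 = trans (∑-cong is split) (∑-comm is (upTo (suc k)) _)
    where
    split : ∀ i → F i ≈ ∑ (upTo (suc k)) (λ m → δ (Vec.sum i) m * F i)
    split i with Vec.sum i ℕₚ.≤? k
    ... | yes |i|≤k = sym (trans (sym (*-distribʳ-∑ (upTo (suc k)) (F i) _))
                        (trans (*-congʳ (∑-δ k |i|≤k)) (*-identityˡ (F i))))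
    ... | no  |i|≰k = let Fi≈0 = F≈0 i (ℕₚ.≰⇒> |i|≰k) in
      trans Fi≈0 (sym (∑-zero (upTo (suc k)) (λ m → trans (*-congˡ Fi≈0) (zeroʳ _))))

  -- Reciprocals of factorials

  -- Division uses an opaque witness of invertibility, so a reciprocal of a product does not unfold
  -- into a product of reciprocals. Reciprocals are therefore always compared through the equation x
  -- y = 1.
  inverse-unique : ∀ {x y z} → x * y ≈ 1# → x * z ≈ 1# → y ≈ z
  inverse-unique {x} {y} {z} xy≈1 xz≈1 = begin
    y            ≈⟨ *-identityʳ y ⟨
    y * 1#       ≈⟨ *-congˡ xz≈1 ⟨
    y * (x * z)  ≈⟨ solve 3 (λ x y z → y :* (x :* z) := (x :* y) :* z) refl x y z ⟩
    x * y * z    ≈⟨ *-congʳ xy≈1 ⟩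
    1# * z       ≈⟨ *-identityˡ z ⟩
    z            ∎

  *-interchange-1 : ∀ {x y u v} → x * u ≈ 1# → y * v ≈ 1# → (x * y) * (u * v) ≈ 1#
  *-interchange-1 {x} {y} {u} {v} xu≈1 yv≈1 = begin
    (x * y) * (u * v)  ≈⟨ solve 4 (λ x y u v → (x :* y) :* (u :* v) := (x :* u) :* (y :* v)) refl x y u v ⟩
    (x * u) * (y * v)  ≈⟨ *-cong xu≈1 yv≈1 ⟩
    1# * 1#            ≈⟨ *-identityˡ 1# ⟩
    1#                 ∎

  /-*-1/ : ∀ x k .{{_ : NonZero k}} → x / k ≈ x * (1# / k)
  /-*-1/ x k = *-congˡ (sym (*-identityˡ _))

  ×-*-1/ : ∀ k .{{_ : NonZero k}} → (k × 1#) * (1# / k) ≈ 1#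
  ×-*-1/ k = begin
    (k × 1#) * (1# / k)  ≈⟨ *-cong (sym k-0≈k) (*-identityˡ _) ⟩
    (k × 1# + - 0#) * proj₁ inverse ≈⟨ proj₂ (proj₂ inverse) ⟩
    1#                   ∎
    where
    inverse = HeytingField.#⇒invertible R (char0 k)
    k-0≈k : k × 1# + - 0# ≈ k × 1#
    k-0≈k = trans (+-congˡ (RingProperties.-0#≈0# ring)) (+-identityʳ _)

  1/! : ℕ → Carrier
  1/! k = (1# / k !) {{ℕₚ._!≢0 k}}

  ×-*-1/! : ∀ k → ((k !) × 1#) * 1/! k ≈ 1#
  ×-*-1/! k = ×-*-1/ (k !) {{ℕₚ._!≢0 k}}

  1/!-zero : 1/! 0 ≈ 1#
  1/!-zero = trans (sym (trans (*-congʳ (+-identityʳ 1#)) (*-identityˡ _))) (×-*-1/! 0)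

  1/!-suc : ∀ k → (suc k × 1#) * 1/! (suc k) ≈ 1/! k
  1/!-suc k = inverse-unique (begin
    ((k !) × 1#) * ((suc k × 1#) * 1/! (suc k))  ≈⟨ solve 3 (λ x y z → x :* (y :* z) := (y :* x) :* z) refl _ _ _ ⟩
    (suc k × 1#) * ((k !) × 1#) * 1/! (suc k)    ≈⟨ *-congʳ (×1-homo-* (suc k) (k !)) ⟨
    ((suc k !) × 1#) * 1/! (suc k)               ≈⟨ ×-*-1/! (suc k) ⟩
    1#                                         ∎) (×-*-1/! k)

  -- A product of reciprocals rather than the reciprocal of `i !ᵥ`, so that a sum over a box factors
  -- one coordinate at a time.
  1/!ᵥ : ∀ {n} → Vec ℕ n → Carrier
  1/!ᵥ i = Vec.foldr′ _*_ 1# (Vec.map 1/! i)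

  ×-*-1/!ᵥ : ∀ {n} (i : Vec ℕ n) → (i !ᵥ × 1#) * 1/!ᵥ i ≈ 1#
  ×-*-1/!ᵥ []      = trans (*-identityʳ _) (+-identityʳ 1#)
  ×-*-1/!ᵥ (k ∷ i) = trans (*-congʳ (×1-homo-* (k !) (i !ᵥ))) (*-interchange-1 (×-*-1/! k) (×-*-1/!ᵥ i))

  -- Weighted sums over the multi-indices of a given degree

  -- Moving the factor k into 1/k! lowers the index; the boundary term is f (b + 1).
  ∑-1/!-shift : ∀ b (f : ℕ → Carrier) → f (suc b) ≈ 0# →
                ∑ (upTo (suc b)) (λ k → (k × 1#) * (1/! k * f k))
                  ≈ ∑ (upTo (suc b)) (λ k → 1/! k * f (suc k))
  ∑-1/!-shift b f f≈0 = begin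
    ∑ (upTo (suc b)) (λ k → (k × 1#) * (1/! k * f k))
      ≡⟨ ∑-upTo-suc b _ ⟩
    0# * (1/! 0 * f 0) + ∑ (upTo b) (λ k → (suc k × 1#) * (1/! (suc k) * f (suc k)))
      ≈⟨ +-cong (zeroˡ _) (∑-cong (upTo b) (λ k → trans (sym (*-assoc _ _ _)) (*-congʳ (1/!-suc k)))) ⟩
    0# + ∑ (upTo b) (λ k → 1/! k * f (suc k))
      ≈⟨ +-comm _ _ ⟩
    ∑ (upTo b) (λ k → 1/! k * f (suc k)) + 0#
      ≈⟨ +-congˡ (trans (*-congˡ f≈0) (zeroʳ _)) ⟨
    ∑ (upTo b) (λ k → 1/! k * f (suc k)) + 1/! b * f (suc b)
      ≈⟨ ∑-upTo-last b _ ⟨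
    ∑ (upTo (suc b)) (λ k → 1/! k * f (suc k)) ∎

  -- For j = 0 the sum over the remaining coordinates is a function of the first entry, to which the
  -- one-variable shift applies. For other j the factor of the first entry is pulled out and the
  -- induction runs on the tail. The hypothesis removes the index with entry b + 1, which the shift
  -- pushes out of the box.
  ∑-1/!ᵥ-shift : ∀ {n} b (j : Fin n) (Φ : Vec ℕ n → Carrier) →
                 (∀ i → b < lookup i j → Φ i ≈ 0#) →
                 ∑ (box n b) (λ i → (lookup i j × 1#) * (1/!ᵥ i * Φ i))
                   ≈ ∑ (box n b) (λ i → 1/!ᵥ i * Φ (i ⁺ j))
  ∑-1/!ᵥ-shift {suc n} b zero Φ Φ≈0 = begin
    ∑ (box (suc n) b) (λ i → (lookup i zero × 1#) * (1/!ᵥ i * Φ i))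
      ≈⟨ ∑-box n b _ ⟩
    ∑ (upTo (suc b)) (λ k → ∑ (box n b) (λ i → (k × 1#) * (1/! k * 1/!ᵥ i * Φ (k ∷ i))))
      ≈⟨ ∑-cong (upTo (suc b)) (λ k → trans (sym (*-distribˡ-∑ (box n b) _ _)) (*-congˡ (factor k k))) ⟩
    ∑ (upTo (suc b)) (λ k → (k × 1#) * (1/! k * f k))
      ≈⟨ ∑-1/!-shift b f (∑-zero (box n b) (λ i → trans (*-congˡ (Φ≈0 (suc b ∷ i) ℕₚ.≤-refl)) (zeroʳ _))) ⟩
    ∑ (upTo (suc b)) (λ k → 1/! k * f (suc k))
      ≈⟨ ∑-cong (upTo (suc b)) (λ k → sym (factor k (suc k))) ⟩
    ∑ (upTo (suc b)) (λ k → ∑ (box n b) (λ i → 1/! k * 1/!ᵥ i * Φ (suc k ∷ i)))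
      ≈⟨ ∑-box n b _ ⟨
    ∑ (box (suc n) b) (λ i → 1/!ᵥ i * Φ (i ⁺ zero)) ∎
    where
    f : ℕ → Carrier
    f k = ∑ (box n b) (λ i → 1/!ᵥ i * Φ (k ∷ i))
    factor : ∀ k l → ∑ (box n b) (λ i → 1/! k * 1/!ᵥ i * Φ (l ∷ i)) ≈ 1/! k * f l
    factor k l = trans (∑-cong (box n b) (λ i → *-assoc _ _ _)) (sym (*-distribˡ-∑ (box n b) _ _))
  ∑-1/!ᵥ-shift {suc n} b (suc j) Φ Φ≈0 = begin
    ∑ (box (suc n) b) (λ i → (lookup i (suc j) × 1#) * (1/!ᵥ i * Φ i))
      ≈⟨ ∑-box n b _ ⟩
    ∑ (upTo (suc b)) (λ k → ∑ (box n b) (λ i → (lookup i j × 1#) * (1/! k * 1/!ᵥ i * Φ (k ∷ i))))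
      ≈⟨ ∑-cong (upTo (suc b)) (λ k → trans
           (∑-cong (box n b) (λ i →
             solve 4 (λ x y z w → x :* (y :* z :* w) := y :* (x :* (z :* w))) refl _ _ _ _))
           (sym (*-distribˡ-∑ (box n b) _ _))) ⟩
    ∑ (upTo (suc b)) (λ k → 1/! k * ∑ (box n b) (λ i → (lookup i j × 1#) * (1/!ᵥ i * Φ (k ∷ i))))
      ≈⟨ ∑-cong (upTo (suc b)) (λ k → *-congˡ (∑-1/!ᵥ-shift b j (Φ ∘ (k ∷_)) (λ i → Φ≈0 (k ∷ i)))) ⟩
    ∑ (upTo (suc b)) (λ k → 1/! k * ∑ (box n b) (λ i → 1/!ᵥ i * Φ (k ∷ i ⁺ j)))
      ≈⟨ ∑-cong (upTo (suc b)) (λ k → trans (*-distribˡ-∑ (box n b) _ _)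
           (∑-cong (box n b) (λ i → sym (*-assoc _ _ _)))) ⟩
    ∑ (upTo (suc b)) (λ k → ∑ (box n b) (λ i → 1/! k * 1/!ᵥ i * Φ (k ∷ i ⁺ j)))
      ≈⟨ ∑-box n b _ ⟨
    ∑ (box (suc n) b) (λ i → 1/!ᵥ i * Φ (i ⁺ suc j)) ∎

  sum-×1 : ∀ {n} (i : Vec ℕ n) → Vec.sum i × 1# ≈ ∑ (allFin n) (λ j → lookup i j × 1#)
  sum-×1 []          = refl
  sum-×1 {suc n} (k ∷ i) = begin
    (k ℕ.+ Vec.sum i) × 1#                            ≈⟨ ×-homo-+ 1# k (Vec.sum i) ⟩
    k × 1# + Vec.sum i × 1#                           ≈⟨ +-congˡ (sum-×1 i) ⟩
    k × 1# + ∑ (allFin n) (λ j → lookup i j × 1#)     ≡⟨ ∑-allFin-suc n (λ j → lookup (k ∷ i) j × 1#) ⟨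
    ∑ (allFin (suc n)) (λ j → lookup (k ∷ i) j × 1#)  ∎

  ∑-degree : ∀ {n} → ℕ → ℕ → (Vec ℕ n → Carrier) → Carrier
  ∑-degree {n} b m Φ = ∑ (box n b) (λ i → 1/!ᵥ i * (δ (Vec.sum i) m * Φ i))

  -- This is S(m, Φ), with the entries of the multi-indices bounded by b. The factor m! absorbs the
  -- scalar m + 1 of Euler's identity.
  multinomialSum : ∀ {n} → ℕ → ℕ → (Vec ℕ n → Carrier) → Carrier
  multinomialSum b m Φ = ((m !) × 1#) * ∑-degree b m Φ

  multinomialSum-cong : ∀ {n} b m {Φ Ψ : Vec ℕ n → Carrier} → (∀ i → Φ i ≈ Ψ i) →
                        multinomialSum b m Φ ≈ multinomialSum b m Ψ
  multinomialSum-cong {n} b m Φ≈Ψ = *-congˡ (∑-cong (box n b) (λ i → *-congˡ (*-congˡ (Φ≈Ψ i))))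

  multinomialSum-*ˡ : ∀ {n} b m x (Φ : Vec ℕ n → Carrier) →
                      multinomialSum b m (λ i → x * Φ i) ≈ x * multinomialSum b m Φ
  multinomialSum-*ˡ {n} b m x Φ = begin
    ((m !) × 1#) * ∑ (box n b) (λ i → 1/!ᵥ i * (δ (Vec.sum i) m * (x * Φ i)))
      ≈⟨ *-congˡ (∑-cong (box n b) (λ i →
           solve 4 (λ w d x y → w :* (d :* (x :* y)) := x :* (w :* (d :* y))) refl _ _ _ _)) ⟩
    ((m !) × 1#) * ∑ (box n b) (λ i → x * (1/!ᵥ i * (δ (Vec.sum i) m * Φ i)))
      ≈⟨ *-congˡ (*-distribˡ-∑ (box n b) x _) ⟨
    ((m !) × 1#) * (x * ∑-degree b m Φ)
      ≈⟨ solve 3 (λ x y z → x :* (y :* z) := y :* (x :* z)) refl _ _ _ ⟩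
    x * multinomialSum b m Φ ∎

  ∑-degree≈ : ∀ {n} b m (Φ : Vec ℕ n → Carrier) → ∑-degree b m Φ ≈ 1/! m * multinomialSum b m Φ
  ∑-degree≈ b m Φ = sym (begin
    1/! m * (((m !) × 1#) * ∑-degree b m Φ)  ≈⟨ solve 3 (λ x y z → x :* (y :* z) := (y :* x) :* z) refl _ _ _ ⟩
    ((m !) × 1#) * 1/! m * ∑-degree b m Φ    ≈⟨ *-congʳ (×-*-1/! m) ⟩
    1# * ∑-degree b m Φ                    ≈⟨ *-identityˡ _ ⟩
    ∑-degree b m Φ                         ∎)

  ∑-degree-zero : ∀ {n} b (Φ : Vec ℕ n → Carrier) → ∑-degree b 0 Φ ≈ Φ (replicate n 0)
  ∑-degree-zero {zero}  b Φ = trans (+-identityʳ _) (trans (*-identityˡ _) (*-identityˡ _))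
  ∑-degree-zero {suc n} b Φ = begin
    ∑-degree b 0 Φ
      ≈⟨ ∑-box n b _ ⟩
    ∑ (upTo (suc b)) (λ k → ∑ (box n b) (λ i → 1/! k * 1/!ᵥ i * (δ (k ℕ.+ Vec.sum i) 0 * Φ (k ∷ i))))
      ≡⟨ ∑-upTo-suc b _ ⟩
    ∑ (box n b) (λ i → 1/! 0 * 1/!ᵥ i * (δ (Vec.sum i) 0 * Φ (0 ∷ i)))
      + ∑ (upTo b) (λ k → ∑ (box n b) (λ i → 1/! (suc k) * 1/!ᵥ i * (0# * Φ (suc k ∷ i))))
      ≈⟨ +-cong
           (∑-cong (box n b) (λ i → *-congʳ (trans (*-congʳ 1/!-zero) (*-identityˡ _))))
           (∑-zero (upTo b) (λ k → ∑-zero (box n b) (λ i → trans (*-congˡ (zeroˡ _)) (zeroʳ _)))) ⟩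
    ∑-degree b 0 (Φ ∘ (0 ∷_)) + 0#
      ≈⟨ +-identityʳ _ ⟩
    ∑-degree b 0 (Φ ∘ (0 ∷_))
      ≈⟨ ∑-degree-zero b (Φ ∘ (0 ∷_)) ⟩
    Φ (replicate (suc n) 0) ∎

  multinomialSum-zero : ∀ {n} b (Φ : Vec ℕ n → Carrier) → multinomialSum b 0 Φ ≈ Φ (replicate n 0)
  multinomialSum-zero b Φ =
    trans (*-congʳ (+-identityʳ 1#)) (trans (*-identityˡ _) (∑-degree-zero b Φ))

  -- Euler's identity: (m + 1) is split as the sum of the entries of the multi-index.
  ∑-degree-suc : ∀ {n b m} → suc m ≤ b → (Φ : Vec ℕ n → Carrier) →
                 (suc m × 1#) * ∑-degree b (suc m) Φ ≈ ∑ (allFin n) (λ j → ∑-degree b m (Φ ∘ (_⁺ j)))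
  ∑-degree-suc {n} {b} {m} m<b Φ = begin
    (suc m × 1#) * ∑-degree b (suc m) Φ
      ≈⟨ *-distribˡ-∑ (box n b) _ _ ⟩
    ∑ (box n b) (λ i → (suc m × 1#) * (1/!ᵥ i * (δ (Vec.sum i) (suc m) * Φ i)))
      ≈⟨ ∑-cong (box n b) euler ⟩
    ∑ (box n b) (λ i → ∑ (allFin n) (λ j → (lookup i j × 1#) * (1/!ᵥ i * Ψ i)))
      ≈⟨ ∑-comm (box n b) (allFin n) _ ⟩
    ∑ (allFin n) (λ j → ∑ (box n b) (λ i → (lookup i j × 1#) * (1/!ᵥ i * Ψ i)))
      ≈⟨ ∑-cong (allFin n) (λ j → ∑-1/!ᵥ-shift b j Ψ (Ψ≈0 j)) ⟩
    ∑ (allFin n) (λ j → ∑ (box n b) (λ i → 1/!ᵥ i * Ψ (i ⁺ j)))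
      -- `δ (suc d) (suc m)` computes to `δ d m`, so the shifted index i + eⱼ of degree m + 1 leaves
      -- i of degree m.
      ≈⟨ ∑-cong (allFin n) (λ j → ∑-cong (box n b) (λ i → *-congˡ (*-congʳ
           (reflexive (≡.cong (λ d → δ d (suc m)) (sum-⁺ i j)))))) ⟩
    ∑ (allFin n) (λ j → ∑-degree b m (Φ ∘ (_⁺ j))) ∎
    where
    Ψ : Vec ℕ n → Carrier
    Ψ i = δ (Vec.sum i) (suc m) * Φ i
    -- An entry above b forces |i| > b ≥ m + 1, against |i| = m + 1. Here the cutoff is seen to be
    -- harmless.
    Ψ≈0 : ∀ j i → b < lookup i j → Ψ i ≈ 0#
    Ψ≈0 j i b<iⱼ = trans (*-congʳ (δ-≢ (λ |i|≡m+1 →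
      ℕₚ.<⇒≱ (ℕₚ.<-≤-trans b<iⱼ (lookup≤sum i j)) (≡.subst (_≤ b) (≡.sym |i|≡m+1) m<b)))) (zeroˡ _)
    euler : ∀ i → (suc m × 1#) * (1/!ᵥ i * (δ (Vec.sum i) (suc m) * Φ i))
                  ≈ ∑ (allFin n) (λ j → (lookup i j × 1#) * (1/!ᵥ i * Ψ i))
    euler i = begin
      (suc m × 1#) * (1/!ᵥ i * (δ (Vec.sum i) (suc m) * Φ i))
        ≈⟨ solve 4 (λ x w d y → x :* (w :* (d :* y)) := (d :* x) :* (w :* y)) refl _ _ _ _ ⟩
      δ (Vec.sum i) (suc m) * (suc m × 1#) * (1/!ᵥ i * Φ i)
        ≈⟨ *-congʳ (δ-subst (Vec.sum i) (suc m) (_× 1#)) ⟨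
      δ (Vec.sum i) (suc m) * (Vec.sum i × 1#) * (1/!ᵥ i * Φ i)
        ≈⟨ solve 4 (λ x w d y → (d :* x) :* (w :* y) := x :* (w :* (d :* y))) refl _ _ _ _ ⟩
      (Vec.sum i × 1#) * (1/!ᵥ i * Ψ i)
        ≈⟨ *-congʳ (sum-×1 i) ⟩
      ∑ (allFin n) (λ j → lookup i j × 1#) * (1/!ᵥ i * Ψ i)
        ≈⟨ *-distribʳ-∑ (allFin n) _ _ ⟩
      ∑ (allFin n) (λ j → (lookup i j × 1#) * (1/!ᵥ i * Ψ i)) ∎

  multinomialSum-suc : ∀ {n b m} → suc m ≤ b → (Φ : Vec ℕ n → Carrier) →
                       multinomialSum b (suc m) Φ ≈ ∑ (allFin n) (λ j → multinomialSum b m (Φ ∘ (_⁺ j)))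
  multinomialSum-suc {n} {b} {m} m<b Φ = begin
    ((suc m !) × 1#) * ∑-degree b (suc m) Φ
      ≈⟨ *-congʳ (×1-homo-* (suc m) (m !)) ⟩
    (suc m × 1#) * ((m !) × 1#) * ∑-degree b (suc m) Φ
      ≈⟨ solve 3 (λ x y z → (x :* y) :* z := y :* (x :* z)) refl _ _ _ ⟩
    ((m !) × 1#) * ((suc m × 1#) * ∑-degree b (suc m) Φ)
      ≈⟨ *-congˡ (∑-degree-suc m<b Φ) ⟩
    ((m !) × 1#) * ∑ (allFin n) (λ j → ∑-degree b m (Φ ∘ (_⁺ j)))
      ≈⟨ *-distribˡ-∑ (allFin n) _ _ ⟩
    ∑ (allFin n) (λ j → multinomialSum b m (Φ ∘ (_⁺ j))) ∎

  -- Power series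

  -- This is s = s₀ + t s′ with s′ the tail of s. Associativity follows from it by induction on k,
  -- without reindexing a double sum.
  *ˢ-suc : ∀ s u k → (s *ˢ u) (suc k) ≈ s 0 * u (suc k) + ((s ∘ suc) *ˢ u) k
  *ˢ-suc s u k = reflexive (∑-upTo-suc (suc k) _)

  *ˢ-congˡ : ∀ s {u v} → u ≈ˢ v → s *ˢ u ≈ˢ s *ˢ v
  *ˢ-congˡ s u≈v k = ∑-cong (upTo (suc k)) (λ j → *-congˡ (u≈v (k ℕ.∸ j)))

  *ˢ-congʳ : ∀ {s v} u → s ≈ˢ v → s *ˢ u ≈ˢ v *ˢ u
  *ˢ-congʳ u s≈v k = ∑-cong (upTo (suc k)) (λ j → *-congʳ (s≈v j))

  *ˢ-identityˡ : ∀ u → 1ˢ *ˢ u ≈ˢ u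
  *ˢ-identityˡ u zero    = trans (+-identityʳ _) (*-identityˡ _)
  *ˢ-identityˡ u (suc k) = begin
    (1ˢ *ˢ u) (suc k)                  ≈⟨ *ˢ-suc 1ˢ u k ⟩
    1# * u (suc k) + (0ˢ *ˢ u) k       ≈⟨ +-cong (*-identityˡ _) (∑-zero (upTo (suc k)) (λ j → zeroˡ _)) ⟩
    u (suc k) + 0#                     ≈⟨ +-identityʳ _ ⟩
    u (suc k)                          ∎

  -- The combination x s + v is the shape that the tail of a product takes in `*ˢ-suc`.
  *ˢ-distribʳ-+ˢ : ∀ x s v u → (λ k → x * s k + v k) *ˢ u ≈ˢ (λ k → x * (s *ˢ u) k + (v *ˢ u) k)
  *ˢ-distribʳ-+ˢ x s v u k = begin
    ∑ (upTo (suc k)) (λ j → (x * s j + v j) * u (k ℕ.∸ j))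
      ≈⟨ ∑-cong (upTo (suc k)) (λ j →
           solve 4 (λ x p q r → (x :* p :+ q) :* r := x :* (p :* r) :+ q :* r) refl _ _ _ _) ⟩
    ∑ (upTo (suc k)) (λ j → x * (s j * u (k ℕ.∸ j)) + v j * u (k ℕ.∸ j))
      ≈⟨ ∑-distrib-+ (upTo (suc k)) _ _ ⟩
    ∑ (upTo (suc k)) (λ j → x * (s j * u (k ℕ.∸ j))) + (v *ˢ u) k
      ≈⟨ +-congʳ (*-distribˡ-∑ (upTo (suc k)) x _) ⟨
    x * (s *ˢ u) k + (v *ˢ u) k ∎

  *ˢ-assoc : ∀ s u v → (s *ˢ u) *ˢ v ≈ˢ s *ˢ (u *ˢ v)
  *ˢ-assoc s u v zero    = +-congʳ (begin
    (s 0 * u 0 + 0#) * v 0      ≈⟨ *-congʳ (+-identityʳ _) ⟩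
    s 0 * u 0 * v 0             ≈⟨ *-assoc _ _ _ ⟩
    s 0 * (u 0 * v 0)           ≈⟨ *-congˡ (+-identityʳ _) ⟨
    s 0 * (u 0 * v 0 + 0#)      ∎)
  *ˢ-assoc s u v (suc k) = begin
    ((s *ˢ u) *ˢ v) (suc k)
      ≈⟨ *ˢ-suc (s *ˢ u) v k ⟩
    (s *ˢ u) 0 * v (suc k) + (((s *ˢ u) ∘ suc) *ˢ v) k
      ≈⟨ +-cong (*-congʳ (+-identityʳ _)) (*ˢ-congʳ v (*ˢ-suc s u) k) ⟩
    s 0 * u 0 * v (suc k) + ((λ k → s 0 * u (suc k) + ((s ∘ suc) *ˢ u) k) *ˢ v) k
      ≈⟨ +-congˡ (*ˢ-distribʳ-+ˢ (s 0) (u ∘ suc) _ v k) ⟩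
    s 0 * u 0 * v (suc k) + (s 0 * ((u ∘ suc) *ˢ v) k + (((s ∘ suc) *ˢ u) *ˢ v) k)
      ≈⟨ +-congˡ (+-congˡ (*ˢ-assoc (s ∘ suc) u v k)) ⟩
    s 0 * u 0 * v (suc k) + (s 0 * ((u ∘ suc) *ˢ v) k + ((s ∘ suc) *ˢ (u *ˢ v)) k)
      ≈⟨ solve 5 (λ x y z p q → x :* y :* z :+ (x :* p :+ q) := x :* (y :* z :+ p) :+ q) refl _ _ _ _ _ ⟩
    s 0 * (u 0 * v (suc k) + ((u ∘ suc) *ˢ v) k) + ((s ∘ suc) *ˢ (u *ˢ v)) k
      ≈⟨ +-congʳ (*-congˡ (*ˢ-suc u v k)) ⟨
    s 0 * (u *ˢ v) (suc k) + ((s ∘ suc) *ˢ (u *ˢ v)) k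
      ≈⟨ *ˢ-suc s (u *ˢ v) k ⟨
    (s *ˢ (u *ˢ v)) (suc k) ∎

  ^ˢ-homo-* : ∀ s m n → (s ^ˢ m) *ˢ (s ^ˢ n) ≈ˢ s ^ˢ (m ℕ.+ n)
  ^ˢ-homo-* s zero    n k = *ˢ-identityˡ (s ^ˢ n) k
  ^ˢ-homo-* s (suc m) n k = trans (*ˢ-assoc s (s ^ˢ m) (s ^ˢ n) k) (*ˢ-congˡ s (^ˢ-homo-* s m n) k)

  monomialˢ-replicate : ∀ {n} s (i : Vec ℕ n) → monomialˢ (replicate n s) i ≈ˢ series s ^ˢ Vec.sum i
  monomialˢ-replicate s []      k = refl
  monomialˢ-replicate s (m ∷ i) k =
    trans (*ˢ-congˡ (series s ^ˢ m) (monomialˢ-replicate s i) k) (^ˢ-homo-* (series s) m (Vec.sum i) k)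

  -- Multiplication by powers of t

  infixr 8 t^_·_

  t^_·_ : ℕ → Series → Series
  (t^ zero  · u) k       = u k
  (t^ suc v · u) zero    = 0#
  (t^ suc v · u) (suc k) = (t^ v · u) k

  -- A shift reads only lower coefficients. The bound is needed because part sizes up to K determine
  -- powers of a series only up to tᴷ.
  t^·-cong-≤ : ∀ {K} v {s u} → (∀ k → k ≤ K → s k ≈ u k) → ∀ k → k ≤ K → (t^ v · s) k ≈ (t^ v · u) k
  t^·-cong-≤ zero    s≈u k       k≤K = s≈u k k≤K
  t^·-cong-≤ (suc v) s≈u zero    k≤K = refl
  t^·-cong-≤ (suc v) s≈u (suc k) k≤K = t^·-cong-≤ v s≈u k (ℕₚ.<⇒≤ k≤K)

  -- As a series, `δ m` is the monomial tᵐ.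
  δ-+ : ∀ v m k → δ (v ℕ.+ m) k ≡ (t^ v · δ m) k
  δ-+ zero    m k       = ≡.refl
  δ-+ (suc v) m zero    = ≡.refl
  δ-+ (suc v) m (suc k) = δ-+ v m k

  -- Expand s as Σ sⱼ tʲ; the terms with j > k do not reach tᵏ, so any K > k gives the same value.
  *ˢ-as-∑ : ∀ K s u k → k < K → ∑ (allFin K) (λ j → s (toℕ j) * (t^ toℕ j · u) k) ≈ (s *ˢ u) k
  *ˢ-as-∑ (suc K) s u zero    _         = begin
    ∑ (allFin (suc K)) (λ j → s (toℕ j) * (t^ toℕ j · u) 0)
      ≡⟨ ∑-allFin-suc K _ ⟩
    s 0 * u 0 + ∑ (allFin K) (λ j → s (suc (toℕ j)) * 0#)
      ≈⟨ +-congˡ (∑-zero (allFin K) (λ j → zeroʳ _)) ⟩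
    (s *ˢ u) 0 ∎
  *ˢ-as-∑ (suc K) s u (suc k) (s≤s k<K) = begin
    ∑ (allFin (suc K)) (λ j → s (toℕ j) * (t^ toℕ j · u) (suc k))
      ≡⟨ ∑-allFin-suc K _ ⟩
    s 0 * u (suc k) + ∑ (allFin K) (λ j → s (suc (toℕ j)) * (t^ toℕ j · u) k)
      ≈⟨ +-congˡ (*ˢ-as-∑ K (s ∘ suc) u k k<K) ⟩
    s 0 * u (suc k) + ((s ∘ suc) *ˢ u) k
      ≈⟨ *ˢ-suc s u k ⟨
    (s *ˢ u) (suc k) ∎

  *ˢ-as-∑-partSizes : ∀ {K} s u k → series s 0 ≈ 0# → k ≤ K →
    ∑ (allFin K) (λ j → series s (lookup (partSizes K) j) * (t^ lookup (partSizes K) j · u) k) ≈ (series s *ˢ u) k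
  *ˢ-as-∑-partSizes {K} s u k s₀≈0 k≤K = begin
    ∑ (allFin K) (λ j → σ (lookup (partSizes K) j) * (t^ lookup (partSizes K) j · u) k)
      ≈⟨ ∑-cong (allFin K) (λ j → reflexive (≡.cong (λ d → σ d * (t^ d · u) k) (lookup-partSizes j))) ⟩
    ∑ (allFin K) (λ j → σ (suc (toℕ j)) * (t^ suc (toℕ j) · u) k)
      ≈⟨ +-identityˡ _ ⟨
    0# + ∑ (allFin K) (λ j → σ (suc (toℕ j)) * (t^ suc (toℕ j) · u) k)
      -- Part sizes start at 1; the missing term j = 0 is restored because s has no constant term.
      ≈⟨ +-congʳ (trans (*-congʳ s₀≈0) (zeroˡ _)) ⟨
    σ 0 * u k + ∑ (allFin K) (λ j → σ (suc (toℕ j)) * (t^ suc (toℕ j) · u) k)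
      ≡⟨ ∑-allFin-suc K (λ j → σ (toℕ j) * (t^ toℕ j · u) k) ⟨
    ∑ (allFin (suc K)) (λ j → σ (toℕ j) * (t^ toℕ j · u) k)
      ≈⟨ *ˢ-as-∑ (suc K) σ u k (s≤s k≤K) ⟩
    (σ *ˢ u) k ∎
    where σ = series s

  -- Powers of a series as sums over partitions

  monomial : ∀ {n} → (ℕ → Carrier) → Vec ℕ n → Vec ℕ n → Carrier
  monomial σ v r = Vec.foldr′ _*_ 1# (Vec.zipWith (λ d rⱼ → σ d ^ rⱼ) v r)

  monomial-⁺ : ∀ {n} σ (v r : Vec ℕ n) j → monomial σ v (r ⁺ j) ≈ σ (lookup v j) * monomial σ v r
  monomial-⁺ σ (d ∷ v) (k ∷ r) zero    = *-assoc _ _ _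
  monomial-⁺ σ (d ∷ v) (k ∷ r) (suc j) = trans (*-congˡ (monomial-⁺ σ v r j))
    (solve 3 (λ x y z → x :* (y :* z) := y :* (x :* z)) refl _ _ _)

  monomial-replicate-0 : ∀ {n} σ (v : Vec ℕ n) → monomial σ v (replicate n 0) ≈ 1#
  monomial-replicate-0 σ []      = refl
  monomial-replicate-0 σ (d ∷ v) = trans (*-identityˡ _) (monomial-replicate-0 σ v)

  monomial-cong : ∀ {n} {σ τ} (v r : Vec ℕ n) → (∀ j → σ (lookup v j) ≈ τ (lookup v j)) →
                  monomial σ v r ≈ monomial τ v r
  monomial-cong []      []      σ≈τ = refl
  monomial-cong (d ∷ v) (k ∷ r) σ≈τ = *-cong (^-congˡ k (σ≈τ zero)) (monomial-cong v r (σ≈τ ∘ suc))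

  monomial-* : ∀ {n} σ τ (v r : Vec ℕ n) → monomial (λ d → σ d * τ d) v r ≈ monomial σ v r * monomial τ v r
  monomial-* σ τ []      []      = sym (*-identityˡ 1#)
  monomial-* σ τ (d ∷ v) (k ∷ r) = trans (*-cong (^-distrib-* (σ d) (τ d) k) (monomial-* σ τ v r))
    (solve 4 (λ p q r s → (p :* q) :* (r :* s) := (p :* r) :* (q :* s)) refl _ _ _ _)

  multinomialSum-t^· : ∀ {n} b m y v (d : Vec ℕ n → ℕ) (g : Vec ℕ n → Carrier) k →
    multinomialSum b m (λ r → (t^ v · δ (d r)) k * (y * g r))
      ≈ y * (t^ v · (λ l → multinomialSum b m (λ r → δ (d r) l * g r))) k
  multinomialSum-t^· {n} b m y zero d g k = trans
    (multinomialSum-cong {n} b m (λ r → solve 3 (λ p q s → p :* (q :* s) := q :* (p :* s)) refl _ _ _))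
    (multinomialSum-*ˡ {n} b m y _)
  multinomialSum-t^· {n} b m y (suc v) d g zero = trans
    (multinomialSum-*ˡ {n} b m 0# _) (trans (zeroˡ _) (sym (zeroʳ y)))
  multinomialSum-t^· b m y (suc v) d g (suc k) = multinomialSum-t^· b m y v d g k

  -- Since m!/(r₁! r₂! ⋯) counts the orderings of the m parts, the sum runs in effect over
  -- compositions of k into m parts. Removing one part lowers k while the range of sizes stays the
  -- same, so K is fixed and k varies below it.
  multinomialSum-partitions : ∀ {K b} s → series s 0 ≈ 0# → ∀ m → m ≤ b → ∀ k → k ≤ K →
    multinomialSum b m (λ (r : Vec ℕ K) → δ (weight r) k * monomial (series s) (partSizes K) r)
      ≈ (series s ^ˢ m) k
  multinomialSum-partitions {K} {b} s s₀≈0 zero m≤b k k≤K = begin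
    multinomialSum b 0 (λ (r : Vec ℕ K) → δ (weight r) k * monomial (series s) (partSizes K) r)
      ≈⟨ multinomialSum-zero {K} b _ ⟩
    δ (weight (replicate K 0)) k * monomial (series s) (partSizes K) (replicate K 0)
      ≈⟨ *-cong (reflexive (≡.cong (λ w → δ w k) (·-replicate-0 (partSizes K)))) (monomial-replicate-0 _ (partSizes K)) ⟩
    δ 0 k * 1#
      ≈⟨ *-identityʳ _ ⟩
    δ 0 k
      ≈⟨ δ0≈1ˢ k ⟩
    1ˢ k ∎
    where
    δ0≈1ˢ : δ 0 ≈ˢ 1ˢ
    δ0≈1ˢ zero    = refl
    δ0≈1ˢ (suc k) = refl
  multinomialSum-partitions {K} {b} s s₀≈0 (suc m) m<b k k≤K = begin
    multinomialSum b (suc m) (λ (r : Vec ℕ K) → δ (weight r) k * monomial σ v r)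
      ≈⟨ multinomialSum-suc {K} m<b _ ⟩
    ∑ (allFin K) (λ j → multinomialSum b m (λ (r : Vec ℕ K) → δ (weight (r ⁺ j)) k * monomial σ v (r ⁺ j)))
      ≈⟨ ∑-cong (allFin K) (λ j → multinomialSum-cong b m (λ r → *-cong
           (reflexive (≡.trans (≡.cong (λ w → δ w k) (·-⁺ v r j)) (δ-+ (lookup v j) (weight r) k)))
           (monomial-⁺ σ v r j))) ⟩
    ∑ (allFin K) (λ j → multinomialSum b m (λ r →
      (t^ lookup v j · δ (weight r)) k * (σ (lookup v j) * monomial σ v r)))
      ≈⟨ ∑-cong (allFin K) (λ j → multinomialSum-t^· b m (σ (lookup v j)) (lookup v j) weight (monomial σ v) k) ⟩
    ∑ (allFin K) (λ j → σ (lookup v j) *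
      (t^ lookup v j · (λ l → multinomialSum b m (λ r → δ (weight r) l * monomial σ v r))) k)
      ≈⟨ ∑-cong (allFin K) (λ j → *-congˡ (t^·-cong-≤ (lookup v j)
           (multinomialSum-partitions s s₀≈0 m (ℕₚ.<⇒≤ m<b)) k k≤K)) ⟩
    ∑ (allFin K) (λ j → σ (lookup v j) * (t^ lookup v j · (σ ^ˢ m)) k)
      ≈⟨ *ˢ-as-∑-partSizes s (σ ^ˢ m) k s₀≈0 k≤K ⟩
    (σ ^ˢ suc m) k ∎
    where
    σ = series s
    v = partSizes K

  ×1-^ : ∀ m n → (m ℕ.^ n) × 1# ≈ (m × 1#) ^ n
  ×1-^ m zero    = +-identityʳ 1#
  ×1-^ m (suc n) = trans (×1-homo-* m (m ℕ.^ n)) (*-congˡ (×1-^ m n))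

  1^ : ∀ n → 1# ^ n ≈ 1#
  1^ zero    = refl
  1^ (suc n) = trans (*-identityˡ _) (1^ n)

  -- For v = `partSizes` this makes `monomial 1/! v r` the reciprocal of λ!.
  ×-*-monomial-1/! : ∀ {n} (v r : Vec ℕ n) →
    (product (Vec.zipWith (λ d k → (d !) ℕ.^ k) v r) × 1#) * monomial 1/! v r ≈ 1#
  ×-*-monomial-1/! []      []      = trans (*-identityʳ _) (+-identityʳ 1#)
  ×-*-monomial-1/! (d ∷ v) (k ∷ r) = trans (*-congʳ (×1-homo-* ((d !) ℕ.^ k) _))
    (*-interchange-1 power (×-*-monomial-1/! v r))
    where
    power : (((d !) ℕ.^ k) × 1#) * 1/! d ^ k ≈ 1#
    power = begin
      (((d !) ℕ.^ k) × 1#) * 1/! d ^ k  ≈⟨ *-congʳ (×1-^ (d !) k) ⟩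
      ((d !) × 1#) ^ k * 1/! d ^ k        ≈⟨ ^-distrib-* _ _ k ⟨
      (((d !) × 1#) * 1/! d) ^ k          ≈⟨ ^-congˡ k (×-*-1/! d) ⟩
      1# ^ k                            ≈⟨ 1^ k ⟩
      1#                                ∎

  -- Moments

  module R[A] = CommutativeRing R[A]

  module PolySolver = Solver R[A].commutativeSemiring

  ^ᵥ-replicate-0 : ∀ {n} (μ : Vec Poly n) → μ ^ᵥ replicate n 0 ≋ con 1#
  ^ᵥ-replicate-0 []      = ≋-refl
  ^ᵥ-replicate-0 (p ∷ μ) = ≋-trans (⊗-idˡ _) (^ᵥ-replicate-0 μ)

  ^ᵥ-⁺ : ∀ {n} (μ : Vec Poly n) i j → μ ^ᵥ (i ⁺ j) ≋ lookup μ j ⊗ μ ^ᵥ i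
  ^ᵥ-⁺ (p ∷ μ) (k ∷ i) zero    = ⊗-assoc _ _ _
  ^ᵥ-⁺ (p ∷ μ) (k ∷ i) (suc j) = ≋-trans (R[A].*-congˡ (^ᵥ-⁺ μ i j))
    (PolySolver.solve 3 (λ x y z → x P.:* (y P.:* z) P.:= y P.:* (x P.:* z)) ≋-refl _ _ _)
    where module P = PolySolver

  gf-1-suc : ∀ m k → series (gf-1 m) (suc k) ≈ m (suc k) * 1/! (suc k)
  gf-1-suc m k = trans (+-congˡ (RingProperties.-0#≈0# ring))
    (trans (+-identityʳ _) (/-*-1/ (m (suc k)) (suc k !) {{ℕₚ._!≢0 (suc k)}}))

  1/!ᵥ-replicate-0 : ∀ n → 1/!ᵥ (replicate n 0) ≈ 1#
  1/!ᵥ-replicate-0 zero    = refl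
  1/!ᵥ-replicate-0 (suc n) = trans (*-cong 1/!-zero (1/!ᵥ-replicate-0 n)) (*-identityˡ 1#)

  -- When the zeroth moment is 1, the constant term prescribed in `gfᵥ` agrees with the general
  -- formula, and the case distinction disappears.
  gfᵥ≈ : ∀ {n} (m : Vec ℕ n → Carrier) → m (replicate n 0) ≈ 1# → ∀ i → gfᵥ m i ≈ 1/!ᵥ i * m i
  gfᵥ≈ {n} m m₀≈1 i with Vecₚ.≡-dec ℕₚ._≟_ i (replicate n 0)
  ... | yes ≡.refl = sym (trans (*-cong (1/!ᵥ-replicate-0 n) m₀≈1) (*-identityˡ 1#))
  ... | no  _      = begin
    (m i / i !ᵥ) {{i !ᵥ≢0}}         ≈⟨ /-*-1/ (m i) (i !ᵥ) {{i !ᵥ≢0}} ⟩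
    m i * (1# / i !ᵥ) {{i !ᵥ≢0}}    ≈⟨ *-congˡ (inverse-unique (×-*-1/ (i !ᵥ) {{i !ᵥ≢0}}) (×-*-1/!ᵥ i)) ⟩
    m i * 1/!ᵥ i                    ≈⟨ *-comm _ _ ⟩
    1/!ᵥ i * m i                    ∎

  -- Evaluation of powers of the sum and the two generating functions

  module EvaluationProperties (ev : Evaluation) where

    open Evaluation ev
    open Moments ev

    -- Linearity of E collects the factors μⱼ produced by Euler's recursion into one more factor of
    -- the sum.
    E-⊗-sumᴾ : ∀ {n} (μ : Vec Poly n) q p →
               ∑ (allFin n) (λ j → E ((q ⊗ lookup μ j) ⊗ p)) ≈ E (q ⊗ (sumᴾ μ ⊗ p))
    E-⊗-sumᴾ []              q p = sym (begin
      E (q ⊗ (con 0# ⊗ p))  ≈⟨ E-cong (R[A].trans (⊗-comm q _) (⊗-assoc _ _ _)) ⟩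
      E (con 0# ⊗ (p ⊗ q))  ≈⟨ E-scalar 0# (p ⊗ q) ⟩
      0# * E (p ⊗ q)        ≈⟨ zeroˡ _ ⟩
      0#                    ∎)
    E-⊗-sumᴾ {suc n} (x ∷ μ) q p = begin
      ∑ (allFin (suc n)) (λ j → E ((q ⊗ lookup (x ∷ μ) j) ⊗ p))
        ≡⟨ ∑-allFin-suc n (λ j → E ((q ⊗ lookup (x ∷ μ) j) ⊗ p)) ⟩
      E ((q ⊗ x) ⊗ p) + ∑ (allFin n) (λ j → E ((q ⊗ lookup μ j) ⊗ p))
        ≈⟨ +-congˡ (E-⊗-sumᴾ μ q p) ⟩
      E ((q ⊗ x) ⊗ p) + E (q ⊗ (sumᴾ μ ⊗ p))
        ≈⟨ E-additive _ _ ⟨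
      E ((q ⊗ x) ⊗ p ⊕ q ⊗ (sumᴾ μ ⊗ p))
        ≈⟨ E-cong (PolySolver.solve 4 (λ q x p s →
             (q P.:* x) P.:* p P.:+ q P.:* (s P.:* p) P.:= q P.:* ((x P.:+ s) P.:* p)) ≋-refl _ _ _ _) ⟩
      E (q ⊗ (sumᴾ (x ∷ μ) ⊗ p)) ∎
      where module P = PolySolver

    multinomialSum-moments : ∀ {n b} (μ : Vec Poly n) m → m ≤ b → ∀ q →
      multinomialSum b m (λ i → E (q ⊗ μ ^ᵥ i)) ≈ E (q ⊗ sumᴾ μ ^ᴾ m)
    multinomialSum-moments {n} {b} μ zero    m≤b q =
      trans (multinomialSum-zero {n} b _) (E-cong (R[A].*-congˡ (^ᵥ-replicate-0 μ)))
    multinomialSum-moments {n} {b} μ (suc m) m<b q = begin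
      multinomialSum b (suc m) (λ i → E (q ⊗ μ ^ᵥ i))
        ≈⟨ multinomialSum-suc {n} m<b _ ⟩
      ∑ (allFin n) (λ j → multinomialSum b m (λ i → E (q ⊗ μ ^ᵥ (i ⁺ j))))
        ≈⟨ ∑-cong (allFin n) (λ j → multinomialSum-cong b m (λ i →
             E-cong (R[A].trans (R[A].*-congˡ (^ᵥ-⁺ μ i j)) (R[A].sym (⊗-assoc _ _ _))))) ⟩
      ∑ (allFin n) (λ j → multinomialSum b m (λ i → E ((q ⊗ lookup μ j) ⊗ μ ^ᵥ i)))
        ≈⟨ ∑-cong (allFin n) (λ j → multinomialSum-moments μ m (ℕₚ.<⇒≤ m<b) (q ⊗ lookup μ j)) ⟩
      ∑ (allFin n) (λ j → E ((q ⊗ lookup μ j) ⊗ sumᴾ μ ^ᴾ m))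
        ≈⟨ E-⊗-sumᴾ μ q (sumᴾ μ ^ᴾ m) ⟩
      E (q ⊗ sumᴾ μ ^ᴾ suc m) ∎

    ∑-degree-moments : ∀ {n b} (μ : Vec Poly n) m → m ≤ b →
                       ∑-degree b m (momentᵥ μ) ≈ 1/! m * E (sumᴾ μ ^ᴾ m)
    ∑-degree-moments {n} {b} μ m m≤b = begin
      ∑-degree b m (momentᵥ μ)
        ≈⟨ ∑-degree≈ {n} b m _ ⟩
      1/! m * multinomialSum b m (momentᵥ μ)
        ≈⟨ *-congˡ (multinomialSum-cong {n} b m (λ i → E-cong (⊗-idˡ _))) ⟨
      1/! m * multinomialSum b m (λ i → E (con 1# ⊗ μ ^ᵥ i))
        ≈⟨ *-congˡ (multinomialSum-moments μ m m≤b (con 1#)) ⟩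
      1/! m * E (con 1# ⊗ sumᴾ μ ^ᴾ m)
        ≈⟨ *-congˡ (E-cong (⊗-idˡ _)) ⟩
      1/! m * E (sumᴾ μ ^ᴾ m) ∎

    -- The coefficients of Σₘ E[pᵐ] sᵐ/m!. Stopping at m = k loses nothing when s has no constant
    -- term, since then sᵐ starts at tᵐ.
    compound : Poly → Series → Series
    compound p s k = ∑ (upTo (suc k)) (λ m → 1/! m * E (p ^ᴾ m) * (s ^ˢ m) k)

    substitution≈compound : ∀ {n} (μ : Vec Poly n) s →
      gfᵥ (momentᵥ μ) [ replicate n s ] ≈ˢ compound (sumᴾ μ) (series s)
    substitution≈compound {n} μ s k = begin
      ∑ (multiIndices≤ n k) (λ i → gfᵥ (momentᵥ μ) i * monomialˢ (replicate n s) i k)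
        ≈⟨ ∑-filter (λ i → Vec.sum i ℕₚ.≤? k) (box n k) _ ⟩
      ∑ (box n k) (λ i → bounded (Vec.sum i) * (gfᵥ (momentᵥ μ) i * monomialˢ (replicate n s) i k))
        ≈⟨ ∑-cong (box n k) (λ i → *-congˡ {bounded (Vec.sum i)} (*-cong
             (gfᵥ≈ (momentᵥ μ) (trans (E-cong (^ᵥ-replicate-0 μ)) E-unit) i) (monomialˢ-replicate s i k))) ⟩
      ∑ (box n k) F
        ≈⟨ ∑-by-degree (box n k) k F (λ i k<|i| → trans (*-congʳ
             (reflexive (≡.cong ⟦_⟧ (dec-false (Vec.sum i ℕₚ.≤? k) (ℕₚ.<⇒≱ k<|i|))))) (zeroˡ _)) ⟩
      ∑ (upTo (suc k)) (λ m → ∑ (box n k) (λ i → δ (Vec.sum i) m * F i))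
        ≈⟨ ∑-upTo-cong (suc k) (λ { m (s≤s m≤k) → degree m m≤k }) ⟩
      compound (sumᴾ μ) (series s) k ∎
      where
      bounded : ℕ → Carrier
      bounded d = ⟦ does (d ℕₚ.≤? k) ⟧
      F : Vec ℕ n → Carrier
      F i = bounded (Vec.sum i) * ((1/!ᵥ i * momentᵥ μ i) * (series s ^ˢ Vec.sum i) k)
      degree : ∀ m → m ≤ k → ∑ (box n k) (λ i → δ (Vec.sum i) m * F i)
                               ≈ 1/! m * E (sumᴾ μ ^ᴾ m) * (series s ^ˢ m) k
      degree m m≤k = begin
        ∑ (box n k) (λ i → δ (Vec.sum i) m * F i)
          -- The degree enters both the truncation indicator and the exponent of s; both become
          -- constants, and the indicator is then 1 because m ≤ k.
          ≈⟨ ∑-cong (box n k) (λ i → δ-subst (Vec.sum i) m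
               (λ d → bounded d * ((1/!ᵥ i * momentᵥ μ i) * (series s ^ˢ d) k))) ⟩
        ∑ (box n k) (λ i → δ (Vec.sum i) m * (bounded m * ((1/!ᵥ i * momentᵥ μ i) * (series s ^ˢ m) k)))
          ≈⟨ ∑-cong (box n k) (λ i → *-congˡ (trans
               (*-congʳ (reflexive (≡.cong ⟦_⟧ (dec-true (m ℕₚ.≤? k) m≤k)))) (*-identityˡ _))) ⟩
        ∑ (box n k) (λ i → δ (Vec.sum i) m * ((1/!ᵥ i * momentᵥ μ i) * (series s ^ˢ m) k))
          ≈⟨ ∑-cong (box n k) (λ i →
               solve 4 (λ d w e x → d :* ((w :* e) :* x) := (w :* (d :* e)) :* x) refl _ _ _ _) ⟩
        ∑ (box n k) (λ i → (1/!ᵥ i * (δ (Vec.sum i) m * momentᵥ μ i)) * (series s ^ˢ m) k)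
          ≈⟨ *-distribʳ-∑ (box n k) _ _ ⟨
        ∑-degree k m (momentᵥ μ) * (series s ^ˢ m) k
          ≈⟨ *-congʳ (∑-degree-moments μ m m≤k) ⟩
        1/! m * E (sumᴾ μ ^ᴾ m) * (series s ^ˢ m) k ∎

    ∑-partitions≈compound : ∀ p s → series s 0 ≈ 0# → ∀ k →
      ∑ (partitions k) (λ r → 1/!ᵥ r * monomial (series s) (partSizes k) r * E (p ^ᴾ ν r))
        ≈ compound p (series s) k
    ∑-partitions≈compound p s s₀≈0 k = begin
      ∑ (partitions k) (λ r → 1/!ᵥ r * mono r * E (p ^ᴾ ν r))
        ≈⟨ ∑-filter (λ r → weight r ℕₚ.≟ k) (box k k) _ ⟩
      ∑ (box k k) F
        -- A partition of k has at most k parts.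
        ≈⟨ ∑-by-degree (box k k) k F (λ r k<|r| → trans (*-congʳ (δ-≢ (λ wt≡k →
             ℕₚ.<⇒≱ k<|r| (≡.subst (ν r ≤_) wt≡k (sum≤weight r))))) (zeroˡ _)) ⟩
      ∑ (upTo (suc k)) (λ m → ∑ (box k k) (λ r → δ (ν r) m * F r))
        ≈⟨ ∑-upTo-cong (suc k) (λ { m (s≤s m≤k) → degree m m≤k }) ⟩
      compound p (series s) k ∎
      where
      mono : Vec ℕ k → Carrier
      mono = monomial (series s) (partSizes k)
      F : Vec ℕ k → Carrier
      F r = δ (weight r) k * (1/!ᵥ r * mono r * E (p ^ᴾ ν r))
      degree : ∀ m → m ≤ k → ∑ (box k k) (λ r → δ (ν r) m * F r) ≈ 1/! m * E (p ^ᴾ m) * (series s ^ˢ m) k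
      degree m m≤k = begin
        ∑ (box k k) (λ r → δ (ν r) m * F r)
          ≈⟨ ∑-cong (box k k) (λ r → δ-subst (ν r) m
               (λ d → δ (weight r) k * (1/!ᵥ r * mono r * E (p ^ᴾ d)))) ⟩
        ∑ (box k k) (λ r → δ (ν r) m * (δ (weight r) k * (1/!ᵥ r * mono r * E (p ^ᴾ m))))
          ≈⟨ ∑-cong (box k k) (λ r →
               solve 5 (λ d c w x e → d :* (c :* (w :* x :* e)) := (w :* (d :* (c :* x))) :* e) refl _ _ _ _ _) ⟩
        ∑ (box k k) (λ r → 1/!ᵥ r * (δ (ν r) m * (δ (weight r) k * mono r)) * E (p ^ᴾ m))
          ≈⟨ *-distribʳ-∑ (box k k) _ _ ⟨
        ∑-degree k m (λ r → δ (weight r) k * mono r) * E (p ^ᴾ m)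
          -- The largest part size K and the cutoff b are both taken to be k.
          ≈⟨ *-congʳ (trans (∑-degree≈ {k} k m _) (*-congˡ (multinomialSum-partitions s s₀≈0 m m≤k k ℕₚ.≤-refl))) ⟩
        1/! m * (series s ^ˢ m) k * E (p ^ᴾ m)
          ≈⟨ solve 3 (λ w x e → w :* x :* e := w :* e :* x) refl _ _ _ ⟩
        1/! m * E (p ^ᴾ m) * (series s ^ˢ m) k ∎

    ·β·-/! : ∀ p γ k → (p ·β· γ) k * 1/! k ≈
      ∑ (partitions k) (λ r → 1/!ᵥ r * monomial (series (gf-1 (moment γ))) (partSizes k) r * E (p ^ᴾ ν r))
    ·β·-/! p γ k = trans (*-distribʳ-∑ (partitions k) (1/! k) _) (∑-cong (partitions k) term)
      where
      g = moment γ
      v = partSizes k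
      term : ∀ r → (((k !) × 1#) / (𝔪! r ℕ.* part! r)) {{ℕₚ.m*n≢0 _ _ {{r !ᵥ≢0}} {{part!≢0 r}}}}
                     * E (p ^ᴾ ν r) * monomial g v r * 1/! k
                   ≈ 1/!ᵥ r * monomial (series (gf-1 g)) v r * E (p ^ᴾ ν r)
      term r = begin
        (((k !) × 1#) / N) * E (p ^ᴾ ν r) * monomial g v r * 1/! k
          ≈⟨ *-congʳ (*-congʳ (*-congʳ (/-*-1/ ((k !) × 1#) N))) ⟩
        ((k !) × 1#) * (1# / N) * E (p ^ᴾ ν r) * monomial g v r * 1/! k
          ≈⟨ solve 5 (λ x y e z w → x :* y :* e :* z :* w := (x :* w) :* (y :* z :* e)) refl _ _ _ _ _ ⟩
        ((k !) × 1#) * 1/! k * ((1# / N) * monomial g v r * E (p ^ᴾ ν r))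
          ≈⟨ trans (*-congʳ (×-*-1/! k)) (*-identityˡ _) ⟩
        (1# / N) * monomial g v r * E (p ^ᴾ ν r)
          -- The reciprocal of 𝔪(λ)! λ! splits, so that each factor 1/j! can join its moment gⱼ.
          ≈⟨ *-congʳ (*-congʳ (inverse-unique (×-*-1/ N) (trans
               (*-congʳ (×1-homo-* (𝔪! r) (part! r)))
               (*-interchange-1 (×-*-1/!ᵥ r) (×-*-monomial-1/! v r))))) ⟩
        1/!ᵥ r * monomial 1/! v r * monomial g v r * E (p ^ᴾ ν r)
          ≈⟨ *-congʳ (trans (*-assoc _ _ _) (*-congˡ (trans (*-comm _ _) (sym (monomial-* g 1/! v r))))) ⟩
        1/!ᵥ r * monomial (λ d → g d * 1/! d) v r * E (p ^ᴾ ν r)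
          ≈⟨ *-congʳ (*-congˡ (monomial-cong v r positive)) ⟩
        1/!ᵥ r * monomial (series (gf-1 g)) v r * E (p ^ᴾ ν r) ∎
        where
        N = 𝔪! r ℕ.* part! r
        instance
          N≢0 : NonZero N
          N≢0 = ℕₚ.m*n≢0 _ _ {{r !ᵥ≢0}} {{part!≢0 r}}
        -- Sizes are positive, and in positive degree the coefficients of f(γ,t) - 1 are gⱼ/j!.
        positive : ∀ j → g (lookup v j) * 1/! (lookup v j) ≈ series (gf-1 g) (lookup v j)
        positive j rewrite lookup-partSizes j = sym (gf-1-suc g (toℕ j))

    compound-zero : ∀ p s → compound p s 0 ≈ 1#
    compound-zero p s = begin
      1/! 0 * E (con 1#) * 1# + 0#  ≈⟨ +-identityʳ _ ⟩
      1/! 0 * E (con 1#) * 1#       ≈⟨ *-identityʳ _ ⟩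
      1/! 0 * E (con 1#)            ≈⟨ *-cong 1/!-zero E-unit ⟩
      1# * 1#                       ≈⟨ *-identityˡ 1# ⟩
      1#                            ∎

    gf-·β·≈compound : ∀ p γ → gf (p ·β· γ) ≈ˢ compound p (series (gf-1 (moment γ)))
    gf-·β·≈compound p γ zero      = sym (compound-zero p (series (gf-1 (moment γ))))
    gf-·β·≈compound p γ k@(suc _) = begin
      gf (p ·β· γ) k          ≈⟨ /-*-1/ ((p ·β· γ) k) (k !) {{ℕₚ._!≢0 k}} ⟩
      (p ·β· γ) k * 1/! k     ≈⟨ ·β·-/! p γ k ⟩
      ∑ (partitions k) (λ r → 1/!ᵥ r * monomial (series s) (partSizes k) r * E (p ^ᴾ ν r))
                              ≈⟨ ∑-partitions≈compound p s (constant≈0 s) k ⟩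
      compound p (series s) k ∎
      where s = gf-1 (moment γ)

theorem3p2 : ∀ {c ℓ₁ ℓ₂ a} (R : HeytingField c ℓ₁ ℓ₂) (char0 : CharacteristicZero R) (A : Set a) →
    let open Umbral R char0 A in
    (ev : Evaluation) → let open Moments ev in
    (n : ℕ) (μ : Vec Poly n) → All IsMonomial μ → (γ : A) →
    gf (sumᴾ μ ·β· γ) ≈ˢ gfᵥ (momentᵥ μ) [ replicate n (gf-1 (moment γ)) ]
theorem3p2 R char0 A ev n μ _ γ k =
  trans (gf-·β·≈compound (sumᴾ μ) γ k) (sym (substitution≈compound μ (gf-1 (moment γ)) k))
  where
  open Umbral R char0 A
  open Moments ev
  open UmbralProperties R char0 A
  open EvaluationProperties ev
  open CommutativeRing (HeytingField-ring R) using (trans; sym)
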